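{- Let $x\in\mathbb{R}$ with $x>5$. Then $$P_a(x)\,P_b(x)>P_{a+b}(x)$$ for all positive integers $a$ and $b$.
   Context: Let $\sigma_2(n)=\sum_{d\mid n}d^2$. The polynomials $P_n(x)$ are defined by $P_0(x)=1$ and $P_n(x)=\frac{x}{n}\sum_{k=1}^n\sigma_2(k)\,P_{n-k}(x)$ for $n\geq1$; equivalently $\sum_{n\ge0}P_n(x)q^n=\prod_{n\ge1}(1-q^n)^{ -nx}$. -}

module Defs where

open import Data.Nat.Base as ℕ using (ℕ; zero; suc; _∸_)
import Data.Nat.Properties as ℕ
open import Data.Nat.Divisibility using (_∣?_)
open import Data.Integer.Base using (+_)
open import Data.Rational.Base as ℚ using (ℚ; 0ℚ; 1ℚ; ½; ∣_∣; Positive; positive)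
import Data.Rational.Properties as ℚ
open import Data.Rational.Solver using (module +-*-Solver)
open import Data.Fin.Base using (Fin; zero; suc; toℕ)
open import Data.List.Base as List using (List; filter; upTo)
open import Data.Nat.ListAction using (sum)
open import Data.Vec.Base using (Vec; []; _∷_; head; lookup)
open import Data.Vec.Functional using (foldr)
open import Data.Product.Base using (∃-syntax; _×_; _,_)
open import Relation.Binary.PropositionalEquality
  using (_≡_; refl; sym; trans; cong; cong₂; subst)

-- Real numbers are Cauchy sequences of rationals, two sequences denoting the
-- same real when their difference tends to 0.  Operations are termwise.

IsCauchy : (ℕ → ℚ) → Set
IsCauchy s = ∀ ε → 0ℚ ℚ.< ε →
  ∃[ N ] ∀ m n → N ℕ.≤ m → N ℕ.≤ n → ∣ s m ℚ.- s n ∣ ℚ.< ε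

record ℝ : Set where
  constructor mkℝ
  field
    seq    : ℕ → ℚ
    cauchy : IsCauchy seq

open ℝ public

fromℚ : ℚ → ℝ
fromℚ q = mkℝ (λ _ → q) λ ε 0<ε →
  0 , λ _ _ _ _ → subst (ℚ._< ε) (cong ∣_∣ (sym (ℚ.+-inverseʳ q))) 0<ε

fromℕ : ℕ → ℝ
fromℕ n = fromℚ (+ n ℚ./ 1)

private
  open +-*-Solver using (solve; _:=_; _:+_; _:*_; _:-_)

  diff-+ : ∀ a b c d → (a ℚ.+ b) ℚ.- (c ℚ.+ d) ≡ (a ℚ.- c) ℚ.+ (b ℚ.- d)
  diff-+ = solve 4 (λ a b c d → (a :+ b) :- (c :+ d) := (a :- c) :+ (b :- d)) refl

  diff-* : ∀ a b c d →
    a ℚ.* b ℚ.- c ℚ.* d ≡ a ℚ.* (b ℚ.- d) ℚ.+ d ℚ.* (a ℚ.- c)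
  diff-* = solve 4 (λ a b c d → a :* b :- c :* d := a :* (b :- d) :+ d :* (a :- c)) refl

  diff+ : ∀ a b → a ≡ (a ℚ.- b) ℚ.+ b
  diff+ = solve 2 (λ a b → a := (a :- b) :+ b) refl

  half>0 : ∀ {ε} → 0ℚ ℚ.< ε → 0ℚ ℚ.< ½ ℚ.* ε
  half>0 {ε} 0<ε =
    ℚ.positive⁻¹ _ {{ℚ.pos*pos⇒pos ½ ε {{positive 0<ε}}}}

  halves : ∀ ε → ½ ℚ.* ε ℚ.+ ½ ℚ.* ε ≡ ε
  halves ε = trans (sym (ℚ.*-distribʳ-+ ε ½ ½)) (ℚ.*-identityˡ ε)

  bounded : ∀ s → IsCauchy s →
    ∃[ B ] Positive B × ∃[ N ] ∀ n → N ℕ.≤ n → ∣ s n ∣ ℚ.≤ B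
  bounded s cs with cs 1ℚ (ℚ.positive⁻¹ 1ℚ)
  ... | N , p = 1ℚ ℚ.+ ∣ s N ∣
              , ℚ.pos+nonNeg⇒pos 1ℚ ∣ s N ∣ {{ℚ.nonNegative (ℚ.0≤∣p∣ (s N))}}
              , N , λ n N≤n → begin
    ∣ s n ∣
      ≡⟨ cong ∣_∣ (diff+ (s n) (s N)) ⟩
    ∣ (s n ℚ.- s N) ℚ.+ s N ∣
      ≤⟨ ℚ.∣p+q∣≤∣p∣+∣q∣ (s n ℚ.- s N) (s N) ⟩
    ∣ s n ℚ.- s N ∣ ℚ.+ ∣ s N ∣
      ≤⟨ ℚ.+-monoˡ-≤ ∣ s N ∣ (ℚ.<⇒≤ (p n N N≤n ℕ.≤-refl)) ⟩
    1ℚ ℚ.+ ∣ s N ∣ ∎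
    where open ℚ.≤-Reasoning

  *-<-mono : ∀ u v U δ → Positive U →
    ∣ u ∣ ℚ.≤ U → ∣ v ∣ ℚ.< δ → ∣ u ℚ.* v ∣ ℚ.< U ℚ.* δ
  *-<-mono u v U δ U>0 u≤U v<δ = begin-strict
    ∣ u ℚ.* v ∣     ≡⟨ ℚ.∣p*q∣≡∣p∣*∣q∣ u v ⟩
    ∣ u ∣ ℚ.* ∣ v ∣ ≤⟨ ℚ.*-monoʳ-≤-nonNeg ∣ v ∣ {{ℚ.nonNegative (ℚ.0≤∣p∣ v)}} u≤U ⟩
    U ℚ.* ∣ v ∣     <⟨ ℚ.*-monoʳ-<-pos U {{U>0}} v<δ ⟩
    U ℚ.* δ         ∎
    where open ℚ.≤-Reasoning

  split : ∀ ε C → 0ℚ ℚ.< ε → Positive C → ∃[ δ ] 0ℚ ℚ.< δ × C ℚ.* δ ≡ ε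
  split ε C 0<ε C>0 = 1/C ℚ.* ε
    , ℚ.positive⁻¹ (1/C ℚ.* ε)
        {{ℚ.pos*pos⇒pos 1/C {{ℚ.1/pos⇒pos C {{C>0}}}} ε {{positive 0<ε}}}}
    , trans (sym (ℚ.*-assoc C 1/C ε))
        (trans (cong (ℚ._* ε) (ℚ.*-inverseʳ C {{C≢0}})) (ℚ.*-identityˡ ε))
    where
    C≢0 = ℚ.pos⇒nonZero C {{C>0}}
    1/C = (ℚ.1/ C) {{C≢0}}

  diff-*-< : ∀ a b c d A B δ → Positive A → Positive B →
    ∣ a ∣ ℚ.≤ A → ∣ d ∣ ℚ.≤ B → ∣ b ℚ.- d ∣ ℚ.< δ → ∣ a ℚ.- c ∣ ℚ.< δ →
    ∣ a ℚ.* b ℚ.- c ℚ.* d ∣ ℚ.< (A ℚ.+ B) ℚ.* δ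
  diff-*-< a b c d A B δ A>0 B>0 a≤A d≤B b-d<δ a-c<δ = begin-strict
    ∣ a ℚ.* b ℚ.- c ℚ.* d ∣
      ≡⟨ cong ∣_∣ (diff-* a b c d) ⟩
    ∣ a ℚ.* (b ℚ.- d) ℚ.+ d ℚ.* (a ℚ.- c) ∣
      ≤⟨ ℚ.∣p+q∣≤∣p∣+∣q∣ (a ℚ.* (b ℚ.- d)) (d ℚ.* (a ℚ.- c)) ⟩
    ∣ a ℚ.* (b ℚ.- d) ∣ ℚ.+ ∣ d ℚ.* (a ℚ.- c) ∣
      <⟨ ℚ.+-mono-< (*-<-mono a (b ℚ.- d) A δ A>0 a≤A b-d<δ)
                    (*-<-mono d (a ℚ.- c) B δ B>0 d≤B a-c<δ) ⟩
    A ℚ.* δ ℚ.+ B ℚ.* δ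
      ≡⟨ sym (ℚ.*-distribʳ-+ δ A B) ⟩
    (A ℚ.+ B) ℚ.* δ ∎
    where open ℚ.≤-Reasoning

  abstract
    +-cauchy : ∀ s t → IsCauchy s → IsCauchy t → IsCauchy (λ n → s n ℚ.+ t n)
    +-cauchy s t cs ct ε 0<ε
      with cs (½ ℚ.* ε) (half>0 0<ε) | ct (½ ℚ.* ε) (half>0 0<ε)
    ... | M , p | N , q = M ℕ.⊔ N , λ m n M⊔N≤m M⊔N≤n → begin-strict
      ∣ (s m ℚ.+ t m) ℚ.- (s n ℚ.+ t n) ∣
        ≡⟨ cong ∣_∣ (diff-+ (s m) (t m) (s n) (t n)) ⟩
      ∣ (s m ℚ.- s n) ℚ.+ (t m ℚ.- t n) ∣
        ≤⟨ ℚ.∣p+q∣≤∣p∣+∣q∣ (s m ℚ.- s n) (t m ℚ.- t n) ⟩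
      ∣ s m ℚ.- s n ∣ ℚ.+ ∣ t m ℚ.- t n ∣
        <⟨ ℚ.+-mono-< (p m n (ℕ.m⊔n≤o⇒m≤o M N M⊔N≤m) (ℕ.m⊔n≤o⇒m≤o M N M⊔N≤n))
                      (q m n (ℕ.m⊔n≤o⇒n≤o M N M⊔N≤m) (ℕ.m⊔n≤o⇒n≤o M N M⊔N≤n)) ⟩
      ½ ℚ.* ε ℚ.+ ½ ℚ.* ε
        ≡⟨ halves ε ⟩
      ε ∎
      where open ℚ.≤-Reasoning

    *-cauchy : ∀ s t → IsCauchy s → IsCauchy t → IsCauchy (λ n → s n ℚ.* t n)
    *-cauchy s t cs ct ε 0<ε =
      let A , A>0 , K , bs = bounded s cs
          B , B>0 , L , bt = bounded t ct
          δ , 0<δ , eq = split ε (A ℚ.+ B) 0<ε (ℚ.pos+pos⇒pos A {{A>0}} B {{B>0}})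
          M , p = cs δ 0<δ
          N , q = ct δ 0<δ
      in (K ℕ.⊔ L) ℕ.⊔ (M ℕ.⊔ N) , λ m n ≤m ≤n →
      let KL≤m = ℕ.m⊔n≤o⇒m≤o (K ℕ.⊔ L) (M ℕ.⊔ N) ≤m
          KL≤n = ℕ.m⊔n≤o⇒m≤o (K ℕ.⊔ L) (M ℕ.⊔ N) ≤n
          MN≤m = ℕ.m⊔n≤o⇒n≤o (K ℕ.⊔ L) (M ℕ.⊔ N) ≤m
          MN≤n = ℕ.m⊔n≤o⇒n≤o (K ℕ.⊔ L) (M ℕ.⊔ N) ≤n
      in subst (∣ s m ℚ.* t m ℚ.- s n ℚ.* t n ∣ ℚ.<_) eq
           (diff-*-< (s m) (t m) (s n) (t n) A B δ A>0 B>0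
             (bs m (ℕ.m⊔n≤o⇒m≤o K L KL≤m))
             (bt n (ℕ.m⊔n≤o⇒n≤o K L KL≤n))
             (q m n (ℕ.m⊔n≤o⇒n≤o M N MN≤m) (ℕ.m⊔n≤o⇒n≤o M N MN≤n))
             (p m n (ℕ.m⊔n≤o⇒m≤o M N MN≤m) (ℕ.m⊔n≤o⇒m≤o M N MN≤n)))

infixl 6 _+_
infixl 7 _*_
infixl 7 _/_
infix  4 _<_ _>_

_+_ : ℝ → ℝ → ℝ
x + y = mkℝ (λ n → seq x n ℚ.+ seq y n) (+-cauchy (seq x) (seq y) (cauchy x) (cauchy y))

_*_ : ℝ → ℝ → ℝ
x * y = mkℝ (λ n → seq x n ℚ.* seq y n) (*-cauchy (seq x) (seq y) (cauchy x) (cauchy y))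

_/_ : ℝ → (n : ℕ) → .{{ℕ.NonZero n}} → ℝ
x / n = x * fromℚ (+ 1 ℚ./ n)

-- Termwise strict inequality would not be invariant under change of
-- representative; the terms must eventually differ by a fixed positive amount.
_<_ : ℝ → ℝ → Set
x < y = ∃[ ε ] 0ℚ ℚ.< ε × ∃[ N ] ∀ n → N ℕ.≤ n → seq x n ℚ.+ ε ℚ.≤ seq y n

_>_ : ℝ → ℝ → Set
x > y = y < x

∑ : ∀ {n} → (Fin n → ℝ) → ℝ
∑ = foldr _+_ (fromℕ 0)

divisors : ℕ → List ℕ
divisors n = filter (_∣? n) (List.map suc (upTo n))

σ₂ : ℕ → ℕ
σ₂ n = sum (List.map (ℕ._^ 2) (divisors n))

-- table x n = P n x ∷ P (n ∸ 1) x ∷ … ∷ P 0 x ∷ [], so that P (suc n ∸ k) x,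
-- for k = suc i, is the entry at index i of table x n.
table : ℝ → (n : ℕ) → Vec ℝ (suc n)
table x zero    = fromℕ 1 ∷ []
table x (suc n) =
  x / suc n * ∑ (λ i → fromℕ (σ₂ (suc (toℕ i))) * lookup (table x n) i) ∷ table x n

P : ℕ → ℝ → ℝ
P n x = head (table x n)

-- The recurrence for P, with k = suc (toℕ i) ranging over 1, …, suc n.
P-suc : ∀ n x →
  P (suc n) x ≡ x / suc n * ∑ {suc n} (λ i →
    fromℕ (σ₂ (suc (toℕ i))) * P (suc n ∸ suc (toℕ i)) x)
P-suc n x = cong-* (x / suc n) (∑ {suc n} f) (∑ {suc n} g) (∑-cong f g λ i →
  cong-* (fromℕ (σ₂ (suc (toℕ i))))
    (lookup (table x n) i) (P (n ∸ toℕ i) x) (lookup-table n i))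
  where
  f g : Fin (suc n) → ℝ
  f i = fromℕ (σ₂ (suc (toℕ i))) * lookup (table x n) i
  g i = fromℕ (σ₂ (suc (toℕ i))) * P (suc n ∸ suc (toℕ i)) x

  cong-* : ∀ c y z → y ≡ z → c * y ≡ c * z
  cong-* c y .y refl = refl

  ∑-cong : ∀ {m} (f g : Fin m → ℝ) → (∀ i → f i ≡ g i) → ∑ f ≡ ∑ g
  ∑-cong {zero}  f g f≗g = refl
  ∑-cong {suc m} f g f≗g =
    cong₂ _+_ {u = ∑ {m} (λ i → f (suc i))} {v = ∑ {m} (λ i → g (suc i))}
      (f≗g zero) (∑-cong (λ i → f (suc i)) (λ i → g (suc i)) λ i → f≗g (suc i))

  lookup-table : ∀ n (i : Fin (suc n)) → lookup (table x n) i ≡ P (n ∸ toℕ i) x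
  lookup-table zero    zero    = refl
  lookup-table (suc n) zero    = refl
  lookup-table (suc n) (suc i) = lookup-table n i

{-# OPTIONS --safe #-}
module Submission where

-- Fix b and induct on a.  In the recurrence for (a + b) P_{a+b}, bound P_{a+b-k} by
-- P_{a-k} P_b when k ≤ a; these terms add up to at most a P_a P_b.  The remaining terms
-- carry σ₂(a + k) P_{b-k} with 1 ≤ k ≤ b, so once σ₂(a + k) ≤ P_a σ₂(k) they add up to at
-- most P_a (b P_b), and (a + b) P_{a+b} ≤ (a + b) P_a P_b follows.  The comparison of
-- divisor sums holds because n² ≤ σ₂(n) ≤ 2 n² and P_a(x) ≥ 2 (a + 1)² for a ≥ 3,
-- with a = 1, 2 done separately.
-- All of this is a statement about rational x; when x ≥ 5 + ε the gap
-- P_a P_b - P_{a+b} is at least ε / (a + b), uniformly in x, hence also for reals.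

import Defs
open import Defs using (σ₂)
open import Data.Fin.Base using (toℕ)
open import Data.Nat.Base as ℕ using (ℕ; zero; suc; _∸_; NonZero; z≤n; s≤s)
import Data.Nat.Properties as ℕ
open import Data.Nat.Divisibility using (_∣_; _∤_; _∣?_; divides; ∣-refl)
open import Data.Nat.ListAction using (sum)
open import Data.Nat.ListAction.Properties using (sum-++)
open import Data.Nat.Tactic.RingSolver using (solve-∀)
open import Data.List.Base using (map; filter; upTo; _∷ʳ_; _++_; _∷_; [])
open import Data.List.Properties using (map-++; filter-++; filter-accept; filter-reject; upTo-∷ʳ)
open import Relation.Nullary using (yes; no; contradiction)
open import Data.Nat.Induction using (<-rec)
open import Data.Integer.Base as ℤ using (+_; +≤+)
import Data.Integer.Properties as ℤ
open import Data.Rational.Base as ℚ using (ℚ; 0ℚ; 1ℚ)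
import Data.Rational.Unnormalised.Base as ℚᵘ
import Data.Rational.Unnormalised.Properties as ℚᵘ
import Data.Rational.Properties as ℚ
open import Data.Rational.Solver using (module +-*-Solver)
open import Data.Product.Base using (_,_)
open import Relation.Binary.PropositionalEquality
  using (_≡_; refl; sym; trans; cong; cong₂; subst; subst₂; module ≡-Reasoning)

-- Bounds for divisor sums, and the comparison sequence `M`.

module Arithmetic where
  open import Data.Nat.Base using (_+_; _*_; _^_; _≤_; _<_)

  -- The cutoff `t` is kept apart from `N` so that it can carry an induction; `σ₂ n` unfolds to
  -- `divisorSum n n`.
  divisorSum : ℕ → ℕ → ℕ
  divisorSum N t = sum (map (_^ 2) (filter (_∣? N) (map suc (upTo t))))

  divisorSum-suc : ∀ N t → divisorSum N (suc t) ≡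
    divisorSum N t + sum (map (_^ 2) (filter (_∣? N) (suc t ∷ [])))
  divisorSum-suc N t = begin
    sq (filter (_∣? N) (map suc (upTo (suc t))))
      ≡⟨ cong (λ ts → sq (filter (_∣? N) (map suc ts))) (upTo-∷ʳ t) ⟨
    sq (filter (_∣? N) (map suc (upTo t ∷ʳ t)))
      ≡⟨ cong (λ ts → sq (filter (_∣? N) ts)) (map-++ suc (upTo t) (t ∷ [])) ⟩
    sq (filter (_∣? N) (map suc (upTo t) ∷ʳ suc t))
      ≡⟨ cong sq (filter-++ (_∣? N) (map suc (upTo t)) (suc t ∷ [])) ⟩
    sum (map (_^ 2) (ds ++ d))
      ≡⟨ cong sum (map-++ (_^ 2) ds d) ⟩
    sum (map (_^ 2) ds ++ map (_^ 2) d)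
      ≡⟨ sum-++ (map (_^ 2) ds) (map (_^ 2) d) ⟩
    sq ds + sq d ∎
    where
    open ≡-Reasoning
    sq = λ ts → sum (map (_^ 2) ts)
    ds = filter (_∣? N) (map suc (upTo t))
    d = filter (_∣? N) (suc t ∷ [])

  divisorSum-suc-∣ : ∀ {N t} → suc t ∣ N →
    divisorSum N (suc t) ≡ divisorSum N t + suc t * suc t
  divisorSum-suc-∣ {N} {t} t∣N = begin
    divisorSum N (suc t)
      ≡⟨ divisorSum-suc N t ⟩
    divisorSum N t + sum (map (_^ 2) (filter (_∣? N) (suc t ∷ [])))
      ≡⟨ cong (λ ts → divisorSum N t + sum (map (_^ 2) ts)) (filter-accept (_∣? N) t∣N) ⟩
    divisorSum N t + (suc t * (suc t * 1) + 0)
      ≡⟨ cong (_+_ (divisorSum N t)) (square (suc t)) ⟩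
    divisorSum N t + suc t * suc t ∎
    where
    open ≡-Reasoning
    square : ∀ n → n * (n * 1) + 0 ≡ n * n
    square = solve-∀

  divisorSum-suc-∤ : ∀ {N t} → suc t ∤ N → divisorSum N (suc t) ≡ divisorSum N t
  divisorSum-suc-∤ {N} {t} t∤N = trans (divisorSum-suc N t)
    (trans (cong (λ ts → divisorSum N t + sum (map (_^ 2) ts)) (filter-reject (_∣? N) t∤N))
      (ℕ.+-identityʳ (divisorSum N t)))

  -- The divisors of N = j T below T are N / i with i > j, and
  -- ∑_{i>j} (N / i)² ≤ N² / j = N T; the induction telescopes 1 / i² ≤ 1 / (i - 1) - 1 / i.
  divisorSum-≤ : ∀ N .{{_ : NonZero N}} t T → T ∣ N → t < T → divisorSum N t ≤ N * T
  divisorSum-≤ N zero T _ _ = z≤n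
  divisorSum-≤ N (suc t) T T∣N t<T with suc t ∣? N
  ... | no t∤N = subst (_≤ N * T) (sym (divisorSum-suc-∤ t∤N))
                   (divisorSum-≤ N t T T∣N (ℕ.<-trans ℕ.≤-refl t<T))
  ... | yes t∣N@(divides i N≡is) with T∣N
  ...   | divides zero N≡0 = contradiction N≡0 (ℕ.≢-nonZero⁻¹ N)
  ...   | divides j@(suc _) N≡jT = ℕ.*-cancelˡ-≤ j (begin
    j * divisorSum N s           ≡⟨ cong (j *_) (divisorSum-suc-∣ t∣N) ⟩
    -- The induction hypothesis is taken with `s`, the divisor just met, in the role of `T`. Then
    -- `j < i` enters twice: to absorb the extra `s * s`, and to replace `suc j` by `i`.
    j * (divisorSum N t + s * s) ≤⟨ ℕ.*-monoʳ-≤ j (ℕ.+-monoˡ-≤ (s * s) (divisorSum-≤ N t s t∣N ℕ.≤-refl)) ⟩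
    j * (N * s + s * s)          ≡⟨ cong (λ n → j * (n * s + s * s)) N≡is ⟩
    j * (i * s * s + s * s)      ≡⟨ expand i j s ⟩
    (j * i + j) * (s * s)        ≤⟨ ℕ.*-monoˡ-≤ (s * s) (ℕ.+-monoʳ-≤ (j * i) (ℕ.<⇒≤ j<i)) ⟩
    (j * i + i) * (s * s)        ≡⟨ cong (_* (s * s)) (ℕ.+-comm (j * i) i) ⟩
    suc j * i * (s * s)          ≤⟨ ℕ.*-monoˡ-≤ (s * s) (ℕ.*-monoˡ-≤ i j<i) ⟩
    i * i * (s * s)              ≡⟨ ℕ.[m*n]*[o*p]≡[m*o]*[n*p] i i s s ⟩
    i * s * (i * s)              ≡⟨ cong₂ _*_ N≡is N≡is ⟨
    N * N                        ≡⟨ cong (N *_) N≡jT ⟩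
    N * (j * T)                  ≡⟨ commute N j T ⟩
    j * (N * T)                  ∎)
    where
    open ℕ.≤-Reasoning
    s = suc t
    expand : ∀ i j s → j * (i * s * s + s * s) ≡ (j * i + j) * (s * s)
    expand = solve-∀
    commute : ∀ N j T → N * (j * T) ≡ j * (N * T)
    commute = solve-∀
    j<i : j < i
    -- If `i ≤ j`, then `j * T = N = i * s ≤ j * s`, so `T ≤ s`, against `t<T`.
    j<i = ℕ.≰⇒> λ i≤j → ℕ.<⇒≱ t<T (ℕ.*-cancelˡ-≤ j
      (subst₂ _≤_ (trans (sym N≡is) N≡jT) refl (ℕ.*-monoˡ-≤ s i≤j)))

  n²≤σ₂ : ∀ n .{{_ : NonZero n}} → n * n ≤ σ₂ n
  n²≤σ₂ n@(suc m) = subst (n * n ≤_) (sym (divisorSum-suc-∣ {n} {m} ∣-refl))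
    (ℕ.m≤n+m (n * n) (divisorSum n m))

  -- The divisor `n` contributes `n * n`; `divisorSum-≤` at `T = n` bounds all proper divisors
  -- together by the same amount.
  σ₂≤2n² : ∀ n .{{_ : NonZero n}} → σ₂ n ≤ n * n + n * n
  σ₂≤2n² n@(suc m) = subst (_≤ n * n + n * n) (sym (divisorSum-suc-∣ {n} {m} ∣-refl))
    (ℕ.+-monoˡ-≤ (n * n) (divisorSum-≤ n m n ∣-refl ℕ.≤-refl))

  1≤σ₂ : ∀ n .{{_ : NonZero n}} → 1 ≤ σ₂ n
  1≤σ₂ n@(suc _) = ℕ.≤-trans (s≤s z≤n) (n²≤σ₂ n)

  -- A lower bound for P n x when x ≥ 5.  The uniform 2 (n + 1)² would exceed P 1 5 = 5.
  M : ℕ → ℕ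
  M 0 = 1
  M 1 = 5
  M 2 = 15
  M (suc (suc (suc n))) = 2 * ((4 + n) * (4 + n))

  5≤M : ∀ n .{{_ : NonZero n}} → 5 ≤ M n
  5≤M 1 = ℕ.≤-refl
  5≤M 2 = ℕ.m≤m+n 5 10
  5≤M (suc (suc (suc n))) = ℕ.≤-trans (ℕ.m≤m+n 5 27)
    (ℕ.*-monoʳ-≤ 2 (ℕ.*-mono-≤ (ℕ.m≤m+n 4 n) (ℕ.m≤m+n 4 n)))

  σ₂-≤-from-squares : ∀ m k c .{{_ : NonZero m}} .{{_ : NonZero k}} →
    m * m + m * m ≤ c * (k * k) → σ₂ m ≤ c * σ₂ k
  σ₂-≤-from-squares m k c m≤ck =
    ℕ.≤-trans (σ₂≤2n² m) (ℕ.≤-trans m≤ck (ℕ.*-monoʳ-≤ c (n²≤σ₂ k)))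

  -- For `a ≥ 3` this rests on `a + k ≤ (a + 1) * k`, and the 2 in `M a` pays for the 2 in `σ₂≤2n²`.
  -- For `a = 1, 2` and `k ≥ 2` the squares are compared by expansion, the nonnegative slack being
  -- written out in `lem`.
  σ₂[a+k]≤M[a]*σ₂[k] : ∀ a k .{{_ : NonZero a}} .{{_ : NonZero k}} →
    σ₂ (a + k) ≤ M a * σ₂ k
  -- At `k = 1` squares are too coarse (they would need `8 ≤ 5` here and `18 ≤ 15` for `a = 2`), so
  -- the values `σ₂ 2 = 5` and `σ₂ 3 = 10` are computed.
  σ₂[a+k]≤M[a]*σ₂[k] 1 1 = ℕ.≤-refl
  σ₂[a+k]≤M[a]*σ₂[k] 1 (suc (suc k)) = σ₂-≤-from-squares (3 + k) (2 + k) 5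
    (ℕ.m+n≤o⇒m≤o _ (ℕ.≤-reflexive (lem k)))
    where
    lem : ∀ k → (3 + k) * (3 + k) + (3 + k) * (3 + k) + (2 + 8 * k + 3 * k * k)
              ≡ 5 * ((2 + k) * (2 + k))
    lem = solve-∀
  σ₂[a+k]≤M[a]*σ₂[k] 2 1 = ℕ.m≤m+n 10 5
  σ₂[a+k]≤M[a]*σ₂[k] 2 (suc (suc k)) = σ₂-≤-from-squares (4 + k) (2 + k) 15
    (ℕ.m+n≤o⇒m≤o _ (ℕ.≤-reflexive (lem k)))
    where
    lem : ∀ k → (4 + k) * (4 + k) + (4 + k) * (4 + k) + (28 + 44 * k + 13 * k * k)
              ≡ 15 * ((2 + k) * (2 + k))
    lem = solve-∀
  σ₂[a+k]≤M[a]*σ₂[k] (suc (suc (suc n))) (suc k) =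
    σ₂-≤-from-squares (3 + n + suc k) (suc k) (M (3 + n)) (begin
      m * m + m * m                       ≤⟨ ℕ.+-mono-≤ (ℕ.*-mono-≤ le le) (ℕ.*-mono-≤ le le) ⟩
      r * r + r * r                       ≡⟨ regroup (4 + n) (suc k) ⟩
      2 * ((4 + n) * (4 + n)) * (suc k * suc k) ∎)
    where
    open ℕ.≤-Reasoning
    m = 3 + n + suc k
    r = (4 + n) * suc k
    expand : ∀ n k → 3 + n + suc k + (3 * k + n * k) ≡ (4 + n) * suc k
    expand = solve-∀
    regroup : ∀ u v → u * v * (u * v) + u * v * (u * v) ≡ 2 * (u * u) * (v * v)
    regroup = solve-∀
    le : m ≤ r
    le = ℕ.m+n≤o⇒m≤o m (ℕ.≤-reflexive (expand n k))

  ∑M : ℕ → ℕ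
  ∑M zero = 0
  ∑M (suc n) = M n + ∑M n

  -- This lets `M` propagate through the recurrence: if `x ≥ 5` and `P_j ≥ M j` for all `j < n`,
  -- then `σ₂ ≥ 1` gives `n P_n ≥ 5 * ∑M n`. Equality holds at `n = 1, 2`, so this argument allows
  -- no larger `M 1` and `M 2`.
  n*M≤5*∑M : ∀ n → n * M n ≤ 5 * ∑M n
  n*M≤5*∑M 0 = z≤n
  n*M≤5*∑M 1 = ℕ.≤-refl
  n*M≤5*∑M 2 = ℕ.≤-refl
  n*M≤5*∑M 3 = ℕ.m≤m+n 96 9
  n*M≤5*∑M (suc m@(suc (suc (suc n)))) = begin
    -- Divided by `2 * (m + 1)`, this is `(m + 2)² ≤ (m + 5) * (m + 1)`.
    suc m * M (suc m)       ≤⟨ ℕ.m+n≤o⇒m≤o _ (ℕ.≤-reflexive (step n)) ⟩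
    5 * M m + m * M m       ≤⟨ ℕ.+-monoʳ-≤ (5 * M m) (n*M≤5*∑M m) ⟩
    5 * M m + 5 * ∑M m      ≡⟨ ℕ.*-distribˡ-+ 5 (M m) (∑M m) ⟨
    5 * ∑M (suc m)          ∎
    where
    open ℕ.≤-Reasoning
    step : ∀ n → (4 + n) * (2 * ((5 + n) * (5 + n))) + (2 * (4 + n) * (7 + 2 * n))
               ≡ 5 * (2 * ((4 + n) * (4 + n))) + (3 + n) * (2 * ((4 + n) * (4 + n)))
    step = solve-∀

-- Natural numbers as rationals, and finite sums.

module Rational where
  open import Data.Rational.Base using (_+_; _*_; _/_; _≤_)
  open Arithmetic using (M; ∑M; 5≤M; 1≤σ₂; n*M≤5*∑M; σ₂[a+k]≤M[a]*σ₂[k])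
  open +-*-Solver using (solve; _:=_; _:+_; _:*_)

  ι : ℕ → ℚ
  ι n = + n / 1

  private
    -- Normalisation by the gcd does not compute on variables, so facts about `ι` are checked on
    -- unnormalised fractions.
    toℚᵘ-/ : ∀ n d .{{_ : NonZero d}} → ℚ.toℚᵘ (+ n / d) ℚᵘ.≃ (+ n ℚᵘ./ d)
    toℚᵘ-/ n (suc d) = ℚ.toℚᵘ-fromℚᵘ (ℚᵘ.mkℚᵘ (+ n) d)

  ι-+ : ∀ m n → ι (m ℕ.+ n) ≡ ι m + ι n
  ι-+ m n = ℚ.toℚᵘ-injective (begin
    ℚ.toℚᵘ (ι (m ℕ.+ n))            ≈⟨ toℚᵘ-/ (m ℕ.+ n) 1 ⟩
    + (m ℕ.+ n) ℚᵘ./ 1              ≡⟨ cong (ℚᵘ._/ 1) (cong₂ ℤ._+_ (ℤ.*-identityʳ (+ m)) (ℤ.*-identityʳ (+ n))) ⟨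
    (+ m ℚᵘ./ 1) ℚᵘ.+ (+ n ℚᵘ./ 1)  ≈⟨ ℚᵘ.+-cong (toℚᵘ-/ m 1) (toℚᵘ-/ n 1) ⟨
    ℚ.toℚᵘ (ι m) ℚᵘ.+ ℚ.toℚᵘ (ι n)  ≈⟨ ℚ.toℚᵘ-homo-+ (ι m) (ι n) ⟨
    ℚ.toℚᵘ (ι m + ι n)              ∎)
    where open ℚᵘ.≃-Reasoning

  ι-* : ∀ m n → ι (m ℕ.* n) ≡ ι m * ι n
  ι-* m n = ℚ.toℚᵘ-injective (begin
    ℚ.toℚᵘ (ι (m ℕ.* n))            ≈⟨ toℚᵘ-/ (m ℕ.* n) 1 ⟩
    + (m ℕ.* n) ℚᵘ./ 1              ≡⟨ cong (ℚᵘ._/ 1) (ℤ.pos-* m n) ⟩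
    (+ m ℚᵘ./ 1) ℚᵘ.* (+ n ℚᵘ./ 1)  ≈⟨ ℚᵘ.*-cong (toℚᵘ-/ m 1) (toℚᵘ-/ n 1) ⟨
    ℚ.toℚᵘ (ι m) ℚᵘ.* ℚ.toℚᵘ (ι n)  ≈⟨ ℚ.toℚᵘ-homo-* (ι m) (ι n) ⟨
    ℚ.toℚᵘ (ι m * ι n)              ∎)
    where open ℚᵘ.≃-Reasoning

  ι-mono-≤ : ∀ {m n} → m ℕ.≤ n → ι m ≤ ι n
  ι-mono-≤ {m} {n} m≤n = ℚ.toℚᵘ-cancel-≤ (begin
    ℚ.toℚᵘ (ι m) ≃⟨ toℚᵘ-/ m 1 ⟩
    + m ℚᵘ./ 1   ≤⟨ ℚᵘ.*≤* (ℤ.*-monoʳ-≤-nonNeg (+ 1) (+≤+ m≤n)) ⟩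
    + n ℚᵘ./ 1   ≃⟨ toℚᵘ-/ n 1 ⟨
    ℚ.toℚᵘ (ι n) ∎)
    where open ℚᵘ.≤-Reasoning

  ι-*-inverseˡ : ∀ n .{{_ : NonZero n}} → + 1 / n * ι n ≡ 1ℚ
  ι-*-inverseˡ n@(suc m) = ℚ.toℚᵘ-injective (begin
    ℚ.toℚᵘ (+ 1 / n * ι n)              ≈⟨ ℚ.toℚᵘ-homo-* (+ 1 / n) (ι n) ⟩
    ℚ.toℚᵘ (+ 1 / n) ℚᵘ.* ℚ.toℚᵘ (ι n)  ≈⟨ ℚᵘ.*-cong (toℚᵘ-/ 1 n) (toℚᵘ-/ n 1) ⟩
    (+ 1 ℚᵘ./ n) ℚᵘ.* (+ n ℚᵘ./ 1)      ≈⟨ ℚᵘ.*≡* (cong +_ (lem n)) ⟩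
    ℚᵘ.1ℚᵘ                              ∎)
    where
    open ℚᵘ.≃-Reasoning
    lem : ∀ n → 1 ℕ.* n ℕ.* 1 ≡ 1 ℕ.* (n ℕ.* 1)
    lem n = ℕ.*-assoc 1 n 1

  0≤ι : ∀ n → 0ℚ ≤ ι n
  0≤ι n = ι-mono-≤ {0} {n} z≤n

  ι-positive : ∀ n .{{_ : NonZero n}} → ℚ.Positive (ι n)
  ι-positive n@(suc _) = ℚ.positive (ℚ.<-≤-trans (ℚ.positive⁻¹ 1ℚ) (ι-mono-≤ {1} {n} (s≤s z≤n)))

  *-monoˡ-≤ : ∀ {p q r} → 0ℚ ≤ r → p ≤ q → r * p ≤ r * q
  *-monoˡ-≤ {r = r} 0≤r = ℚ.*-monoˡ-≤-nonNeg r {{ℚ.nonNegative 0≤r}}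

  *-monoʳ-≤ : ∀ {p q r} → 0ℚ ≤ r → p ≤ q → p * r ≤ q * r
  *-monoʳ-≤ {r = r} 0≤r = ℚ.*-monoʳ-≤-nonNeg r {{ℚ.nonNegative 0≤r}}

  0≤p*q : ∀ {p q} → 0ℚ ≤ p → 0ℚ ≤ q → 0ℚ ≤ p * q
  0≤p*q {p} {q} 0≤p 0≤q = subst (_≤ p * q) (ℚ.*-zeroʳ p) (*-monoˡ-≤ 0≤p 0≤q)

  ∑< : ℕ → (ℕ → ℚ) → ℚ
  ∑< zero    g = 0ℚ
  ∑< (suc n) g = g 0 + ∑< n (λ i → g (suc i))

  ∑<-mono-≤ : ∀ n {g h} → (∀ i → i ℕ.< n → g i ≤ h i) → ∑< n g ≤ ∑< n h
  ∑<-mono-≤ zero    g≤h = ℚ.≤-refl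
  ∑<-mono-≤ (suc n) g≤h =
    ℚ.+-mono-≤ (g≤h 0 (s≤s z≤n)) (∑<-mono-≤ n λ i i<n → g≤h (suc i) (s≤s i<n))

  ∑<-+ : ∀ m n g → ∑< (m ℕ.+ n) g ≡ ∑< m g + ∑< n (λ i → g (m ℕ.+ i))
  ∑<-+ zero    n g = sym (ℚ.+-identityˡ _)
  ∑<-+ (suc m) n g = trans (cong (_+_ (g 0)) (∑<-+ m n (λ i → g (suc i)))) (sym (ℚ.+-assoc (g 0) _ _))

  *-distribˡ-∑< : ∀ c n g → c * ∑< n g ≡ ∑< n (λ i → c * g i)
  *-distribˡ-∑< c zero    g = ℚ.*-zeroʳ c
  *-distribˡ-∑< c (suc n) g = trans (ℚ.*-distribˡ-+ c (g 0) _)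
    (cong (_+_ (c * g 0)) (*-distribˡ-∑< c n (λ i → g (suc i))))

  ι-∑M : ∀ n → ι (∑M n) ≡ ∑< n (λ i → ι (M (n ∸ suc i)))
  ι-∑M zero    = refl
  ι-∑M (suc n) = trans (ι-+ (M n) (∑M n)) (cong (_+_ (ι (M n))) (ι-∑M n))

  -- The coefficient of `q^n` in the product of the generating series of `σ₂` (from `k = 1`) and
  -- `f`.
  σ₂-conv : (ℕ → ℚ) → ℕ → ℚ
  σ₂-conv f n = ∑< n (λ i → ι (σ₂ (suc i)) * f (n ∸ suc i))

  -- Quantitative submultiplicativity for rational solutions of the recurrence.

  module Recurrence
    (q ε : ℚ) (0≤ε : 0ℚ ≤ ε) (5+ε≤q : ι 5 + ε ≤ q)
    (f : ℕ → ℚ) (f0≡1 : f 0 ≡ 1ℚ) (f-rec : ∀ n → ι n * f n ≡ q * σ₂-conv f n)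
    where

    open ℚ.≤-Reasoning

    5≤q : ι 5 ≤ q
    5≤q = ℚ.≤-trans (subst (_≤ ι 5 + ε) (ℚ.+-identityʳ (ι 5)) (ℚ.+-monoʳ-≤ (ι 5) 0≤ε)) 5+ε≤q

    0≤q : 0ℚ ≤ q
    0≤q = ℚ.≤-trans (0≤ι 5) 5≤q

    -- The factor `q` is not yet lowered to 5, so that the same estimate yields both `M≤f` and, from
    -- `q ≥ 5 + ε`, the sharper `M+ε≤f`.
    q*M≤5*f : ∀ n .{{_ : NonZero n}} → (∀ {j} → j ℕ.< n → ι (M j) ≤ f j) →
      q * ι (M n) ≤ ι 5 * f n
    q*M≤5*f n M≤f = ℚ.*-cancelˡ-≤-pos (ι n) {{ι-positive n}} (begin
      ι n * (q * ι (M n))        ≡⟨ swap (ι n) q (ι (M n)) ⟩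
      q * (ι n * ι (M n))        ≡⟨ cong (_*_ q) (ι-* n (M n)) ⟨
      q * ι (n ℕ.* M n)          ≤⟨ *-monoˡ-≤ 0≤q (ι-mono-≤ (n*M≤5*∑M n)) ⟩
      q * ι (5 ℕ.* ∑M n)         ≡⟨ cong (_*_ q) (ι-* 5 (∑M n)) ⟩
      q * (ι 5 * ι (∑M n))       ≡⟨ swap q (ι 5) (ι (∑M n)) ⟩
      ι 5 * (q * ι (∑M n))       ≤⟨ *-monoˡ-≤ (0≤ι 5) (*-monoˡ-≤ 0≤q ∑M≤conv) ⟩
      ι 5 * (q * σ₂-conv f n)    ≡⟨ cong (_*_ (ι 5)) (f-rec n) ⟨
      ι 5 * (ι n * f n)          ≡⟨ swap (ι 5) (ι n) (f n) ⟩
      ι n * (ι 5 * f n)          ∎)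
      where
      swap : ∀ u v w → u * (v * w) ≡ v * (u * w)
      swap = solve 3 (λ u v w → u :* (v :* w) := v :* (u :* w)) refl

      ∑M≤conv : ι (∑M n) ≤ σ₂-conv f n
      ∑M≤conv = subst (_≤ σ₂-conv f n) (sym (ι-∑M n)) (∑<-mono-≤ n λ i i<n →
        let Mj = ι (M (n ∸ suc i)) in begin
        Mj                     ≡⟨ ℚ.*-identityˡ Mj ⟨
        1ℚ * Mj                ≤⟨ *-monoʳ-≤ (0≤ι (M (n ∸ suc i))) (ι-mono-≤ (1≤σ₂ (suc i))) ⟩
        ι (σ₂ (suc i)) * Mj    ≤⟨ *-monoˡ-≤ (0≤ι (σ₂ (suc i))) (M≤f (ℕ.∸-monoʳ-< (s≤s z≤n) i<n)) ⟩
        ι (σ₂ (suc i)) * f (n ∸ suc i) ∎)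

    M≤f : ∀ n → ι (M n) ≤ f n
    M≤f = <-rec _ λ where
      zero      _   → ℚ.≤-reflexive (sym f0≡1)
      n@(suc _) rec → ℚ.*-cancelˡ-≤-pos (ι 5)
        (ℚ.≤-trans (*-monoʳ-≤ (0≤ι (M n)) 5≤q) (q*M≤5*f n rec))

    -- Since `M n ≥ 5`, `5 * (M n + ε) ≤ (5 + ε) * M n`. This surplus `ε` is the source of the
    -- strict inequality.
    M+ε≤f : ∀ n .{{_ : NonZero n}} → ι (M n) + ε ≤ f n
    M+ε≤f n = ℚ.*-cancelˡ-≤-pos (ι 5) (begin
      ι 5 * (ι (M n) + ε)         ≡⟨ ℚ.*-distribˡ-+ (ι 5) (ι (M n)) ε ⟩
      ι 5 * ι (M n) + ι 5 * ε     ≤⟨ ℚ.+-monoʳ-≤ (ι 5 * ι (M n)) (*-monoʳ-≤ 0≤ε (ι-mono-≤ (5≤M n))) ⟩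
      ι 5 * ι (M n) + ι (M n) * ε ≡⟨ factor (ι 5) (ι (M n)) ε ⟩
      (ι 5 + ε) * ι (M n)         ≤⟨ *-monoʳ-≤ (0≤ι (M n)) 5+ε≤q ⟩
      q * ι (M n)                 ≤⟨ q*M≤5*f n (λ {j} _ → M≤f j) ⟩
      ι 5 * f n                   ∎)
      where
      factor : ∀ u v w → u * v + v * w ≡ (u + w) * v
      factor = solve 3 (λ u v w → u :* v :+ v :* w := (u :+ w) :* v) refl

    0≤f : ∀ n → 0ℚ ≤ f n
    0≤f n = ℚ.≤-trans (0≤ι (M n)) (M≤f n)

    1≤f : ∀ n .{{_ : NonZero n}} → 1ℚ ≤ f n
    1≤f n = ℚ.≤-trans (ι-mono-≤ (ℕ.≤-trans (s≤s z≤n) (5≤M n))) (M≤f n)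

    -- The second convolution is weighted by `M a` rather than `f a`, which leaves the difference
    -- `f a - M a ≥ ε` for `gap`.
    conv-≤ : ∀ a b .{{_ : NonZero a}} → (∀ {j} → j ℕ.< a → f (j ℕ.+ b) ≤ f j * f b) →
      σ₂-conv f (a ℕ.+ b) ≤ σ₂-conv f a * f b + ι (M a) * σ₂-conv f b
    conv-≤ a b sub = begin
      σ₂-conv f (a ℕ.+ b)
        ≡⟨ ∑<-+ a b _ ⟩
      ∑< a (λ i → ι (σ₂ (suc i)) * f (a ℕ.+ b ∸ suc i)) +
      ∑< b (λ i → ι (σ₂ (suc (a ℕ.+ i))) * f (a ℕ.+ b ∸ suc (a ℕ.+ i)))
        ≤⟨ ℚ.+-mono-≤ (∑<-mono-≤ a low) (∑<-mono-≤ b high) ⟩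
      ∑< a (λ i → f b * (ι (σ₂ (suc i)) * f (a ∸ suc i))) +
      ∑< b (λ i → ι (M a) * (ι (σ₂ (suc i)) * f (b ∸ suc i)))
        ≡⟨ cong₂ _+_ (*-distribˡ-∑< (f b) a _) (*-distribˡ-∑< (ι (M a)) b _) ⟨
      f b * σ₂-conv f a + ι (M a) * σ₂-conv f b
        ≡⟨ cong (λ s → s + ι (M a) * σ₂-conv f b) (ℚ.*-comm (f b) (σ₂-conv f a)) ⟩
      σ₂-conv f a * f b + ι (M a) * σ₂-conv f b ∎
      where
      rotate : ∀ u v w → u * (v * w) ≡ w * (u * v)
      rotate = solve 3 (λ u v w → u :* (v :* w) := w :* (u :* v)) refl

      low : ∀ i → i ℕ.< a →
        ι (σ₂ (suc i)) * f (a ℕ.+ b ∸ suc i) ≤ f b * (ι (σ₂ (suc i)) * f (a ∸ suc i))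
      low i i<a = begin
        ι (σ₂ (suc i)) * f (a ℕ.+ b ∸ suc i)
          ≡⟨ cong (λ n → ι (σ₂ (suc i)) * f n) (ℕ.+-∸-comm b i<a) ⟩
        ι (σ₂ (suc i)) * f (a ∸ suc i ℕ.+ b)
          ≤⟨ *-monoˡ-≤ (0≤ι (σ₂ (suc i))) (sub (ℕ.∸-monoʳ-< (s≤s z≤n) i<a)) ⟩
        ι (σ₂ (suc i)) * (f (a ∸ suc i) * f b)
          ≡⟨ rotate (ι (σ₂ (suc i))) (f (a ∸ suc i)) (f b) ⟩
        f b * (ι (σ₂ (suc i)) * f (a ∸ suc i)) ∎

      high : ∀ i → i ℕ.< b →
        ι (σ₂ (suc (a ℕ.+ i))) * f (a ℕ.+ b ∸ suc (a ℕ.+ i)) ≤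
        ι (M a) * (ι (σ₂ (suc i)) * f (b ∸ suc i))
      high i _ = begin
        ι (σ₂ (suc (a ℕ.+ i))) * f (a ℕ.+ b ∸ suc (a ℕ.+ i))
          ≡⟨ cong (λ n → ι (σ₂ n) * f (a ℕ.+ b ∸ n)) (ℕ.+-suc a i) ⟨
        ι (σ₂ (a ℕ.+ suc i)) * f (a ℕ.+ b ∸ (a ℕ.+ suc i))
          ≡⟨ cong (λ n → ι (σ₂ (a ℕ.+ suc i)) * f n) (ℕ.[m+n]∸[m+o]≡n∸o a b (suc i)) ⟩
        ι (σ₂ (a ℕ.+ suc i)) * f (b ∸ suc i)
          ≤⟨ *-monoʳ-≤ (0≤f (b ∸ suc i)) (ι-mono-≤ (σ₂[a+k]≤M[a]*σ₂[k] a (suc i))) ⟩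
        ι (M a ℕ.* σ₂ (suc i)) * f (b ∸ suc i)
          ≡⟨ cong (λ c → c * f (b ∸ suc i)) (ι-* (M a) (σ₂ (suc i))) ⟩
        ι (M a) * ι (σ₂ (suc i)) * f (b ∸ suc i)
          ≡⟨ ℚ.*-assoc (ι (M a)) (ι (σ₂ (suc i))) (f (b ∸ suc i)) ⟩
        ι (M a) * (ι (σ₂ (suc i)) * f (b ∸ suc i)) ∎

    -- The recurrence turns `q` times each convolution in `conv-≤` back into a value of `f`, and
    -- `M+ε≤f` absorbs the `ε` term. With submultiplicativity below `a` as a hypothesis, the
    -- estimate serves both inside the induction and after it.
    gap : ∀ a b .{{_ : NonZero a}} → (∀ {j} → j ℕ.< a → f (j ℕ.+ b) ≤ f j * f b) →
      ι (a ℕ.+ b) * f (a ℕ.+ b) + ε * (ι b * f b) ≤ ι (a ℕ.+ b) * (f a * f b)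
    gap a b sub = begin
      ι (a ℕ.+ b) * f (a ℕ.+ b) + ε * (ι b * f b)
        ≡⟨ cong (λ s → s + ε * (ι b * f b)) (f-rec (a ℕ.+ b)) ⟩
      q * σ₂-conv f (a ℕ.+ b) + ε * (ι b * f b)
        ≤⟨ ℚ.+-monoˡ-≤ (ε * (ι b * f b)) (*-monoˡ-≤ 0≤q (conv-≤ a b sub)) ⟩
      q * (σ₂-conv f a * f b + ι (M a) * σ₂-conv f b) + ε * (ι b * f b)
        ≡⟨ distribute q (σ₂-conv f a) (f b) (ι (M a)) (σ₂-conv f b) (ε * (ι b * f b)) ⟩
      q * σ₂-conv f a * f b + ι (M a) * (q * σ₂-conv f b) + ε * (ι b * f b)
        ≡⟨ cong₂ (λ s t → s * f b + ι (M a) * t + ε * (ι b * f b)) (f-rec a) (f-rec b) ⟨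
      ι a * f a * f b + ι (M a) * (ι b * f b) + ε * (ι b * f b)
        ≡⟨ collect (ι a * f a * f b) (ι (M a)) ε (ι b * f b) ⟩
      ι a * f a * f b + (ι (M a) + ε) * (ι b * f b)
        ≤⟨ ℚ.+-monoʳ-≤ (ι a * f a * f b) (*-monoʳ-≤ (0≤p*q (0≤ι b) (0≤f b)) (M+ε≤f a)) ⟩
      ι a * f a * f b + f a * (ι b * f b)
        ≡⟨ factor (ι a) (ι b) (f a) (f b) ⟩
      (ι a + ι b) * (f a * f b)
        ≡⟨ cong (λ n → n * (f a * f b)) (ι-+ a b) ⟨
      ι (a ℕ.+ b) * (f a * f b) ∎
      where
      distribute : ∀ q u v m w e → q * (u * v + m * w) + e ≡ q * u * v + m * (q * w) + e
      distribute = solve 6 (λ q u v m w e →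
        q :* (u :* v :+ m :* w) :+ e := q :* u :* v :+ m :* (q :* w) :+ e) refl
      collect : ∀ u m e w → u + m * w + e * w ≡ u + (m + e) * w
      collect = solve 4 (λ u m e w → u :+ m :* w :+ e :* w := u :+ (m :+ e) :* w) refl
      factor : ∀ a b u v → a * u * v + u * (b * v) ≡ (a + b) * (u * v)
      factor = solve 4 (λ a b u v → a :* u :* v :+ u :* (b :* v) := (a :+ b) :* (u :* v)) refl

    submultiplicative : ∀ b a → f (a ℕ.+ b) ≤ f a * f b
    submultiplicative b = <-rec _ λ where
      -- The induction starts at 0 because the term `k = a` of the convolution calls on `j = 0`.
      zero      _   → ℚ.≤-reflexive (sym (trans (cong (λ c → c * f b) f0≡1) (ℚ.*-identityˡ (f b))))
      a@(suc _) rec → ℚ.*-cancelˡ-≤-pos (ι (a ℕ.+ b)) {{ι-positive (a ℕ.+ b)}} (begin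
        ι (a ℕ.+ b) * f (a ℕ.+ b)
          ≡⟨ ℚ.+-identityʳ _ ⟨
        ι (a ℕ.+ b) * f (a ℕ.+ b) + 0ℚ
          ≤⟨ ℚ.+-monoʳ-≤ (ι (a ℕ.+ b) * f (a ℕ.+ b)) (0≤p*q 0≤ε (0≤p*q (0≤ι b) (0≤f b))) ⟩
        ι (a ℕ.+ b) * f (a ℕ.+ b) + ε * (ι b * f b)
          ≤⟨ gap a b rec ⟩
        ι (a ℕ.+ b) * (f a * f b) ∎)

    uniform-gap : ∀ a b .{{_ : NonZero (a ℕ.+ b)}} .{{_ : NonZero a}} .{{_ : NonZero b}} →
      f (a ℕ.+ b) + (+ 1 / (a ℕ.+ b)) * ε ≤ f a * f b
    uniform-gap a b = ℚ.*-cancelˡ-≤-pos (ι n) {{ι-positive n}} (begin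
      ι n * (f n + (+ 1 / n) * ε)
        ≡⟨ expand (ι n) (f n) (+ 1 / n) ε ⟩
      ι n * f n + ε * ((+ 1 / n) * ι n)
        ≡⟨ cong (λ c → ι n * f n + ε * c) (ι-*-inverseˡ n) ⟩
      -- The two factors 1 are the lower bounds for `ι b` and `f b`.
      ι n * f n + ε * (1ℚ * 1ℚ)
        ≤⟨ ℚ.+-monoʳ-≤ (ι n * f n) (*-monoˡ-≤ 0≤ε
             (ℚ.≤-trans (*-monoʳ-≤ (0≤ι 1) (ι-mono-≤ (ℕ.>-nonZero⁻¹ b))) (*-monoˡ-≤ (0≤ι b) (1≤f b)))) ⟩
      ι n * f n + ε * (ι b * f b)
        ≤⟨ gap a b (λ {j} _ → submultiplicative b j) ⟩
      ι n * (f a * f b) ∎)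
      where
      n = a ℕ.+ b
      expand : ∀ n p r e → n * (p + r * e) ≡ n * p + e * (r * n)
      expand = solve 4 (λ n p r e → n :* (p :+ r :* e) := n :* p :+ e :* (r :* n)) refl

-- Termwise evaluation of the polynomials.

module Evaluation (x : Defs.ℝ) (i : ℕ) where
  open import Data.Rational.Base using (_+_; _*_; _/_)
  open Rational using (ι; ∑<; σ₂-conv; ι-*-inverseˡ)

  value : ℕ → ℚ
  value n = Defs.seq (Defs.P n x) i

  seq-∑ : ∀ n (g : ℕ → Defs.ℝ) →
    Defs.seq (Defs.∑ {n} (λ k → g (toℕ k))) i ≡ ∑< n (λ k → Defs.seq (g k) i)
  seq-∑ zero    g = refl
  seq-∑ (suc n) g = cong (_+_ (Defs.seq (g 0) i)) (seq-∑ n (λ k → g (suc k)))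

  -- Real operations act termwise, so the `i`-th terms obey the recurrence at the rational
  -- `seq x i`. With the division by `n` cleared, it also holds at `n = 0`, where both sides vanish.
  value-rec : ∀ n → ι n * value n ≡ Defs.seq x i * σ₂-conv value n
  value-rec zero    = trans (ℚ.*-zeroˡ (value 0)) (sym (ℚ.*-zeroʳ (Defs.seq x i)))
  value-rec (suc n) = begin
    ι (suc n) * value (suc n)
      ≡⟨ cong (λ y → ι (suc n) * Defs.seq y i) (Defs.P-suc n x) ⟩
    ι (suc n) * (q * r * Defs.seq (Defs.∑ {suc n} (λ k → term (toℕ k))) i)
      ≡⟨ cong (λ s → ι (suc n) * (q * r * s)) (seq-∑ (suc n) term) ⟩
    ι (suc n) * (q * r * σ₂-conv value (suc n))
      ≡⟨ rotate (ι (suc n)) q r (σ₂-conv value (suc n)) ⟩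
    r * ι (suc n) * (q * σ₂-conv value (suc n))
      ≡⟨ cong (λ c → c * (q * σ₂-conv value (suc n))) (ι-*-inverseˡ (suc n)) ⟩
    1ℚ * (q * σ₂-conv value (suc n))
      ≡⟨ ℚ.*-identityˡ _ ⟩
    q * σ₂-conv value (suc n) ∎
    where
    open ≡-Reasoning
    open +-*-Solver using (solve; _:=_; _:*_)
    q = Defs.seq x i
    r = + 1 / suc n
    term : ℕ → Defs.ℝ
    term k = Defs.fromℕ (σ₂ (suc k)) Defs.* Defs.P (suc n ∸ suc k) x
    rotate : ∀ u q r s → u * (q * r * s) ≡ r * u * (q * s)
    rotate = solve 4 (λ u q r s → u :* (q :* r :* s) := r :* u :* (q :* s)) refl

-- Passage to real arguments.

open import Defs

theorem1p3 : (x : ℝ) → x > fromℕ 5 →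
    (a b : ℕ) → 1 ℕ.≤ a → 1 ℕ.≤ b →
    P a x * P b x > P (a ℕ.+ b) x
theorem1p3 x (ε , 0<ε , N , 5+ε≤x) a@(suc _) b@(suc _) _ _ =
  -- Both `ε` and `N` come from `x > 5`; `δ = ε / (a + b)` is the gap of `uniform-gap`, the same for
  -- every term `i ≥ N`, as the order on reals demands.
  δ , ℚ.positive⁻¹ δ {{ℚ.pos*pos⇒pos r {{ℚ.normalize-pos 1 (a ℕ.+ b)}} ε {{ℚ.positive 0<ε}}}}
  , N , λ i N≤i → let open Evaluation x i in
      Rational.Recurrence.uniform-gap (seq x i) ε (ℚ.<⇒≤ 0<ε) (5+ε≤x i N≤i)
        value refl value-rec a b
  where
  r = + 1 ℚ./ (a ℕ.+ b)
  δ = r ℚ.* ε
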